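{- Let $M$ be a matroid on a finite ground set $E$ and $<$ a linear order on $E$. Then the $h$-vector of the external activity complex $\mathrm{Act}_<(M)$ equals the $h$-vector of the independence complex $IN(M)$ (both $h$-vectors being regarded as sequences $(h_0,h_1,\dots)$ extended by zeros).
   Context: For a basis $B$ and $e\in E-B$, $\mathrm{Circ}(B,e)$ is the unique circuit in $B\cup e$; $EA(B)=\{e\in E-B: e=\min_<\mathrm{Circ}(B,e)\}$, $EP(B)=(E-B)-EA(B)$. With $\overline{E}$ a disjoint copy of $E$ and $\overline{S}$ the copy of $S\subseteq E$, $\mathrm{Act}_<(M)$ is the simplicial complex on $E\sqcup\overline{E}$ with facets $F(B)=B\cup EP(B)\cup\overline{B\cup EA(B)}$, $B$ a basis. $IN(M)$ is the complex of independent sets of $M$. For a $(d-1)$-dimensional complex with $f_i$ faces of size $i$, the $h$-vector is defined by $\sum_{i=0}^d f_i(x-1)^{d-i}=\sum_{i=0}^d h_ix^{d-i}$. -}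

module Defs where

open import Level using (0ℓ)
open import Data.Bool using (Bool; true; false)
open import Data.Nat as ℕ using (ℕ; zero; suc; _∸_; _⊔_)
open import Data.Nat.Combinatorics renaming (_C_ to choose) using ()
open import Data.Integer as ℤ using (ℤ)
open import Data.Fin using (Fin)
open import Data.Fin.Subset using (Subset; _∈_; _∉_; _⊆_; _⊂_; _∪_; ⁅_⁆; ∣_∣; ⊥)
open import Data.Fin.Subset.Properties using (_∈?_; _⊆?_; _⊂?_; anySubset?)
open import Data.Fin.Properties using (all?)
open import Data.List using (List; []; _∷_; map; filter; foldr; length; upTo; concatMap)
open import Data.Vec using ([]; _∷_)
open import Data.Product using (_×_; _,_; ∃; proj₁; proj₂)
open import Data.Sum using (_⊎_)
open import Relation.Nullary using (¬_; Dec; yes; no)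
open import Relation.Nullary.Decidable using (_×-dec_; _⊎-dec_; ¬?; _→-dec_; map′)
open import Relation.Unary using (Pred; Decidable)
open import Relation.Binary using (Rel; IsStrictTotalOrder)
open import Relation.Binary.PropositionalEquality using (_≡_; _≢_)

record Matroid (n : ℕ) : Set₁ where
  field
    Independent  : Subset n → Set
    independent? : Decidable Independent
    empty-indep  : Independent ⊥
    hereditary   : ∀ {A B} → A ⊆ B → Independent B → Independent A
    augmentation : ∀ {A B} → Independent A → Independent B → ∣ A ∣ ℕ.< ∣ B ∣ →
                   ∃ λ x → x ∈ B × x ∉ A × Independent (⁅ x ⁆ ∪ A)

module _ {n : ℕ} (M : Matroid n) where
  open Matroid M

  Basis : Subset n → Set
  Basis B = Independent B × (∀ A → B ⊂ A → ¬ Independent A)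

  Circuit : Subset n → Set
  Circuit C = ¬ Independent C × (∀ D → D ⊂ C → Independent D)

  basis? : Decidable Basis
  basis? B = independent? B ×-dec
    map′ (λ h A B⊂A iA → h (A , B⊂A , iA)) (λ h (A , B⊂A , iA) → h A B⊂A iA)
         (¬? (anySubset? (λ A → (B ⊂? A) ×-dec independent? A)))

  circuit? : Decidable Circuit
  circuit? C = ¬? (independent? C) ×-dec
    map′ (λ h D D⊂C → Data.Sum.[ (λ iD → iD) , (λ niD → Data.Empty.⊥-elim (h (D , D⊂C , niD))) ]′ (dec⊎ D))
         (λ h (D , D⊂C , niD) → niD (h D D⊂C))
         (¬? (anySubset? (λ D → (D ⊂? C) ×-dec ¬? (independent? D))))
    where
    import Data.Sum
    import Data.Empty
    dec⊎ : ∀ D → Independent D ⊎ ¬ Independent D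
    dec⊎ D with independent? D
    ... | yes p = Data.Sum.inj₁ p
    ... | no ¬p = Data.Sum.inj₂ ¬p

  module _ {_≺_ : Rel (Fin n) 0ℓ} (ord : IsStrictTotalOrder _≡_ _≺_) where
    open IsStrictTotalOrder ord using (_≟_; _<?_)

    IsMin : Subset n → Fin n → Set
    IsMin C e = e ∈ C × (∀ x → x ∈ C → x ≢ e → e ≺ x)

    isMin? : ∀ C e → Dec (IsMin C e)
    isMin? C e = (e ∈? C) ×-dec all? (λ x → (x ∈? C) →-dec (¬? (x ≟ e) →-dec (e <? x)))

    -- e ∈ EA(B): e ∉ B and e is the minimum of Circ(B,e), the (unique)
    -- circuit contained in B ∪ e.
    EA : Subset n → Fin n → Set
    EA B e = e ∉ B × ∃ λ C → Circuit C × C ⊆ (⁅ e ⁆ ∪ B) × IsMin C e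

    EA? : ∀ B e → Dec (EA B e)
    EA? B e = ¬? (e ∈? B) ×-dec
      anySubset? (λ C → circuit? C ×-dec ((C ⊆? (⁅ e ⁆ ∪ B)) ×-dec isMin? C e))

    EP : Subset n → Fin n → Set
    EP B e = e ∉ B × ¬ EA B e

    EP? : ∀ B e → Dec (EP B e)
    EP? B e = ¬? (e ∈? B) ×-dec ¬? (EA? B e)

    -- Faces of Act_<(M).  A subset of E ⊔ Ē is represented as a pair (S , T)
    -- with S ⊆ E the unbarred part and T ⊆ E the barred part.  It is a face
    -- iff it is contained in some facet F(B) = B ∪ EP(B) ∪ bar(B ∪ EA(B)).
    ActFace : Subset n × Subset n → Set
    ActFace (S , T) = ∃ λ B → Basis B
      × (∀ x → x ∈ S → x ∈ B ⊎ EP B x)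
      × (∀ x → x ∈ T → x ∈ B ⊎ EA B x)

    actFace? : Decidable ActFace
    actFace? (S , T) = anySubset? (λ B → basis? B ×-dec
       (all? (λ x → (x ∈? S) →-dec ((x ∈? B) ⊎-dec EP? B x)) ×-dec
        all? (λ x → (x ∈? T) →-dec ((x ∈? B) ⊎-dec EA? B x))))

allSubsets : (n : ℕ) → List (Subset n)
allSubsets zero    = [] ∷ []
allSubsets (suc n) = map (true ∷_) (allSubsets n) Data.List.++ map (false ∷_) (allSubsets n)
  where import Data.List

allPairs : (n : ℕ) → List (Subset n × Subset n)
allPairs n = concatMap (λ S → map (S ,_) (allSubsets n)) (allSubsets n)

-- h-vector of a finite simplicial complex, computed from the list of the
-- sizes of all its faces (one entry per face).
--   d   = max face size (complex of dimension d-1),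
--   f i = number of faces of size i,
--   Σ_i f_i (x-1)^(d-i) = Σ_k h_k x^(d-k), i.e. (coefficient of x^(d-k))
--   h_k = Σ_{i=0}^{k} (-1)^(k-i) C(d-i, k-i) f_i   for k ≤ d,
--   h_k = 0 for k > d (extension by zeros).

faceDim : List ℕ → ℕ
faceDim = foldr _⊔_ 0

fVec : List ℕ → ℕ → ℕ
fVec sizes i = length (filter (λ s → s ℕ.≟ i) sizes)

sign : ℕ → ℤ
sign zero    = ℤ.+ 1
sign (suc m) = ℤ.- sign m

hVector : List ℕ → ℕ → ℤ
hVector sizes k with k ℕ.≤? faceDim sizes
... | no _  = ℤ.+ 0
... | yes _ = foldr ℤ._+_ (ℤ.+ 0) (map term (upTo (suc k)))
  where
  d = faceDim sizes
  term : ℕ → ℤ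
  term i = sign (k ∸ i) ℤ.* ℤ.+ ((choose (d ∸ i) (k ∸ i)) ℕ.* fVec sizes i)

INSizes : {n : ℕ} → Matroid n → List ℕ
INSizes {n} M = map ∣_∣ (filter (Matroid.independent? M) (allSubsets n))

ActSizes : {n : ℕ} (M : Matroid n) {_≺_ : Rel (Fin n) 0ℓ} →
           IsStrictTotalOrder _≡_ _≺_ → List ℕ
ActSizes {n} M ord =
  map (λ p → ∣ proj₁ p ∣ ℕ.+ ∣ proj₂ p ∣) (filter (actFace? M ord) (allPairs n))

{-# OPTIONS --safe #-}

-- Call e broken in T ⊆ E when e is the minimum of a circuit C with C - e ⊆ T, i.e. when e lies
-- in the closure of { t ∈ T : e ≺ t }, and let Z(T) be the set of elements broken in T.
-- Then (S , T) is a face of Act iff S ∩ Z(T) = ∅, while T is independent iff T ∩ Z(T) = ∅.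
-- Since Z(T) depends only on T ∖ Z(T), exchanging S and T inside Z(T) is a size-preserving
-- involution on all pairs; it matches the faces of Act with the pairs (A , I), A ⊆ E
-- arbitrary and I independent.  So Act has the face numbers of the join of IN with a full
-- simplex on n vertices, and coning does not change the h-vector.
module Submission where

open import Defs
open import Level using (0ℓ)
open import Data.Nat using (ℕ)
open import Data.Fin using (Fin)
open import Relation.Binary using (Rel; IsStrictTotalOrder; tri<; tri≈; tri>)
open import Relation.Binary.PropositionalEquality
  using (_≡_; _≢_; refl; sym; trans; cong; cong₂; subst; setoid; module ≡-Reasoning)
open import Function using (_∘_; id; flip; case_of_)
open import Function.Bundles using (mk⇔)
open import Data.Bool using (true; false; if_then_else_)
open import Data.Empty using (⊥-elim)
open import Data.Nat as ℕ using (zero; suc; _∸_; _⊔_; z≤n; s≤s)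
import Data.Nat.Properties as ℕₚ
open import Data.Nat.Combinatorics using (nCk+nC[k+1]≡[n+1]C[k+1]; k>n⇒nCk≡0) renaming (_C_ to choose)
open import Data.Integer as ℤ using (ℤ; 0ℤ)
import Data.Integer.Properties as ℤₚ
open import Data.Integer.Solver using (module +-*-Solver)
open import Data.Fin.Induction using (spo-wellFounded; spo-noetherian)
import Data.Fin.Properties as Finₚ
open import Data.Fin.Subset
  using (Subset; _∈_; _∉_; _⊆_; _⊂_; _⊃_; _∪_; _─_; _-_; ⁅_⁆; ∣_∣)
open import Data.Fin.Subset.Induction using (⊂-wellFounded; ⊃-wellFounded)
open import Data.Fin.Subset.Properties
open import Data.List
  using (List; []; _∷_; _++_; map; filter; foldr; concatMap; applyUpTo; upTo;
         cartesianProduct; cartesianProductWith)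
import Data.List.Properties as Listₚ
open import Data.List.Membership.Propositional using () renaming (_∈_ to _∈ˡ_)
open import Data.List.Membership.Propositional.Properties
  using (∈-map⁺; ∈-map⁻; ∈-++⁺ˡ; ∈-++⁺ʳ; ∈-cartesianProduct⁺)
open import Data.List.Membership.Propositional.Properties.WithK using (unique∧set⇒bag)
open import Data.List.Relation.Binary.BagAndSetEquality using (∼bag⇒↭)
open import Data.List.Relation.Binary.Permutation.Propositional
  using (_↭_; ↭⇒↭ₛ; module PermutationReasoning)
import Data.List.Relation.Binary.Permutation.Propositional.Properties as ↭ₚ
import Data.List.Relation.Binary.Permutation.Setoid.Properties as ↭ₛₚ
open import Data.List.Relation.Unary.All as All using (All; []; _∷_)
open import Data.List.Relation.Unary.Any using (here)
import Data.List.Relation.Unary.AllPairs as AllPairs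
open import Data.List.Relation.Unary.Unique.Propositional using (Unique)
import Data.List.Relation.Unary.Unique.Propositional.Properties as Uniqueₚ
open import Data.Product using (_×_; _,_; ∃; proj₁; proj₂)
open import Data.Sum using (_⊎_; inj₁; inj₂; [_,_]′; map₁; map₂)
open import Data.Vec using ([]; _∷_; tabulate; here; there)
import Data.Vec.Properties as Vecₚ
open import Induction.WellFounded using (Acc; acc)
open import Relation.Nullary using (¬_; yes; no; contradiction; does)
open import Relation.Nullary.Decidable using (_×-dec_; ¬?; decidable-stable; dec-true)
open import Relation.Unary using (Pred; Decidable)

private variable
  n : ℕ

-- Closure and broken circuits

module _ {P : Pred (Fin n) 0ℓ} (P? : Decidable P) where

  abstract
    comprehension : Subset n
    comprehension = tabulate (does ∘ P?)

    ∈-comprehension⁺ : ∀ {x} → P x → x ∈ comprehension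
    ∈-comprehension⁺ {x} px =
      Vecₚ.lookup⇒[]= x _ (trans (Vecₚ.lookup∘tabulate (does ∘ P?) x) (dec-true (P? x) px))

    ∈-comprehension⁻ : ∀ {x} → x ∈ comprehension → P x
    ∈-comprehension⁻ {x} x∈
      with P? x | trans (sym (Vecₚ.lookup∘tabulate (does ∘ P?) x)) (Vecₚ.[]=⇒lookup x∈)
    ... | yes px | _  = px
    ... | no  _  | ()

∈-∪⁻ : ∀ {e x} {X : Subset n} → x ∈ ⁅ e ⁆ ∪ X → x ≡ e ⊎ x ∈ X
∈-∪⁻ {e = e} {X = X} = map₁ (x∈⁅y⁆⇒x≡y e) ∘ x∈p∪q⁻ ⁅ e ⁆ X

e∈⁅e⁆∪ : ∀ e (X : Subset n) → e ∈ ⁅ e ⁆ ∪ X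
e∈⁅e⁆∪ e X = p⊆p∪q X (x∈⁅x⁆ e)

⊆⁅e⁆∪ : ∀ e (X : Subset n) → X ⊆ ⁅ e ⁆ ∪ X
⊆⁅e⁆∪ e X = q⊆p∪q ⁅ e ⁆ X

⁅e⁆∪-⊆ : ∀ {e} {X Y : Subset n} → e ∈ Y → X ⊆ Y → ⁅ e ⁆ ∪ X ⊆ Y
⁅e⁆∪-⊆ {e = e} {X} {Y} e∈Y X⊆Y x∈ = case ∈-∪⁻ x∈ of λ where
  (inj₁ refl) → e∈Y
  (inj₂ x∈X)  → X⊆Y x∈X

⁅e⁆∪-mono : ∀ {e} {X Y : Subset n} → X ⊆ Y → ⁅ e ⁆ ∪ X ⊆ ⁅ e ⁆ ∪ Y
⁅e⁆∪-mono {e = e} {X} {Y} X⊆Y = ⁅e⁆∪-⊆ (e∈⁅e⁆∪ e Y) (⊆⁅e⁆∪ e Y ∘ X⊆Y)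

⊂-⁅e⁆∪ : ∀ {e} {X : Subset n} → e ∉ X → X ⊂ ⁅ e ⁆ ∪ X
⊂-⁅e⁆∪ {e = e} {X} e∉X = ⊆⁅e⁆∪ e X , e , e∈⁅e⁆∪ e X , e∉X

x∈p─q⇒x∉q : ∀ {x} (p q : Subset n) → x ∈ p ─ q → x ∉ q
x∈p─q⇒x∉q (_ ∷ p) (true ∷ q) (there x∈) (there x∈q) = x∈p─q⇒x∉q p q x∈ x∈q
x∈p─q⇒x∉q (_ ∷ p) (false ∷ q) (there x∈) (there x∈q) = x∈p─q⇒x∉q p q x∈ x∈q

x∈p-y⇒x≢y : ∀ {x} (p : Subset n) y → x ∈ p - y → x ≢ y
x∈p-y⇒x≢y p y x∈ = x∉⁅y⁆⇒x≢y (x∈p─q⇒x∉q p ⁅ y ⁆ x∈)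

⊆⁅e⁆∪[-e] : ∀ (p : Subset n) e → p ⊆ ⁅ e ⁆ ∪ (p - e)
⊆⁅e⁆∪[-e] p e {x} x∈p with x Finₚ.≟ e
... | yes refl = e∈⁅e⁆∪ e (p - e)
... | no  x≢e  = ⊆⁅e⁆∪ e (p - e) (x∈p∧x≢y⇒x∈p-y x∈p x≢e)

-- Closure and circuits from the augmentation axiom

module _ {n : ℕ} (M : Matroid n) where
  open Matroid M

  -- While `A` is smaller than `B`, an element of `B` is adjoined; this stops because `A` grows
  -- strictly within a finite set.
  augment-up-to : ∀ {A B} → Independent A → Independent B →
    ∃ λ Y → Independent Y × A ⊆ Y × Y ⊆ A ∪ B × ∣ B ∣ ℕ.≤ ∣ Y ∣
  augment-up-to {A} {B} iA iB = go A (⊃-wellFounded A) iA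
    where
    go : ∀ A → Acc _⊃_ A → Independent A →
      ∃ λ Y → Independent Y × A ⊆ Y × Y ⊆ A ∪ B × ∣ B ∣ ℕ.≤ ∣ Y ∣
    go A (acc rec) iA with ∣ A ∣ ℕ.<? ∣ B ∣
    ... | no  A≮B = A , iA , ⊆-refl , p⊆p∪q B , ℕₚ.≮⇒≥ A≮B
    ... | yes A<B =
      let x , x∈B , x∉A , ixA = augmentation iA iB A<B
          Y , iY , xA⊆Y , Y⊆ , B≤Y = go (⁅ x ⁆ ∪ A) (rec (⊂-⁅e⁆∪ x∉A)) ixA
      in Y , iY , xA⊆Y ∘ ⊆⁅e⁆∪ x A
       , (λ y∈Y → case x∈p∪q⁻ (⁅ x ⁆ ∪ A) B (Y⊆ y∈Y) of λ where
            (inj₁ y∈xA) → ⁅e⁆∪-⊆ (q⊆p∪q A B x∈B) (p⊆p∪q B) y∈xA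
            (inj₂ y∈B)  → q⊆p∪q A B y∈B)
       , B≤Y

  -- For independent `X`, lying in the closure means lying in `X` or becoming dependent when
  -- adjoined. If `s ∉ X` and `⁅ s ⁆ ∪ X` were independent, `D` would extend inside
  -- `D ∪ (⁅ s ⁆ ∪ X)` to some `Y` larger than `X`. The `t ∈ Y` that augments `X` cannot come from
  -- `D`, which lies in the closure, nor be `s`, as `⁅ s ⁆ ∪ D ⊆ Y` would then be independent.
  closure-transitive : ∀ {X D s} → Independent X → Independent D →
    (∀ {t} → t ∈ D → t ∈ X ⊎ ¬ Independent (⁅ t ⁆ ∪ X)) →
    ¬ Independent (⁅ s ⁆ ∪ D) → s ∈ X ⊎ ¬ Independent (⁅ s ⁆ ∪ X)
  closure-transitive {X} {D} {s} iX iD D⊆clX s∈clD with s ∈? X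
  ... | yes s∈X = inj₁ s∈X
  ... | no  s∉X = inj₂ λ isX →
    let Y , iY , D⊆Y , Y⊆D∪sX , sX≤Y = augment-up-to iD isX
        t , t∈Y , t∉X , itX =
          augmentation iX iY (ℕₚ.<-≤-trans (p⊂q⇒∣p∣<∣q∣ (⊂-⁅e⁆∪ s∉X)) sX≤Y)
    in case x∈p∪q⁻ D (⁅ s ⁆ ∪ X) (Y⊆D∪sX t∈Y) of λ where
      (inj₁ t∈D)  → [ t∉X , (λ ¬itX → ¬itX itX) ]′ (D⊆clX t∈D)
      (inj₂ t∈sX) → case ∈-∪⁻ t∈sX of λ where
        (inj₁ t≡s) → s∈clD (hereditary (⁅e⁆∪-⊆ (subst (_∈ Y) t≡s t∈Y) D⊆Y) iY)
        (inj₂ t∈X)  → t∉X t∈X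

  dependent⇒circuit : ∀ {A} → ¬ Independent A → ∃ λ C → Circuit M C × C ⊆ A
  dependent⇒circuit {A} = go A (⊂-wellFounded A)
    where
    go : ∀ A → Acc _⊂_ A → ¬ Independent A → ∃ λ C → Circuit M C × C ⊆ A
    go A (acc rec) ¬iA with anySubset? (λ D → (D ⊂? A) ×-dec ¬? (independent? D))
    ... | yes (D , D⊂A , ¬iD) =
      let C , circ , C⊆D = go D (rec D⊂A) ¬iD in C , circ , p⊂q⇒p⊆q D⊂A ∘ C⊆D
    ... | no none =
      A , (¬iA , λ D D⊂A → decidable-stable (independent? D) λ ¬iD → none (D , D⊂A , ¬iD))
        , ⊆-refl

  -- The circuit is the fundamental circuit Circ(X,e).
  dependent⇒circuit∋ : ∀ {X e} → Independent X → ¬ Independent (⁅ e ⁆ ∪ X) →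
    ∃ λ C → Circuit M C × C ⊆ ⁅ e ⁆ ∪ X × e ∈ C
  dependent⇒circuit∋ {X} {e} iX ¬ieX with dependent⇒circuit ¬ieX
  ... | C , circ , C⊆eX with e ∈? C
  ... | yes e∈C = C , circ , C⊆eX , e∈C
  ... | no  e∉C = contradiction (hereditary C⊆X iX) (proj₁ circ)
    where
    C⊆X : C ⊆ X
    C⊆X x∈C = case ∈-∪⁻ (C⊆eX x∈C) of λ where
      (inj₁ refl) → contradiction x∈C e∉C
      (inj₂ x∈X)  → x∈X

  circuit-minus : ∀ {C e} → Circuit M C → e ∈ C → Independent (C - e)
  circuit-minus {C} {e} circ e∈C = proj₂ circ (C - e) (x∈p⇒p-x⊂p e∈C)

  circuit-minus-plus : ∀ {C e} → Circuit M C → ¬ Independent (⁅ e ⁆ ∪ (C - e))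
  circuit-minus-plus {C} {e} circ i = proj₁ circ (hereditary (⊆⁅e⁆∪[-e] C e) i)

  module _ {_≺_ : Rel (Fin n) 0ℓ} (ord : IsStrictTotalOrder _≡_ _≺_) where
    open IsStrictTotalOrder ord using (compare; _<?_; isStrictPartialOrder)
      renaming (irrefl to ≺-irrefl; trans to ≺-trans; asym to ≺-asym)

    ≺-least : ∀ {P : Pred (Fin n) 0ℓ} → Decidable P → ∃ P →
      ∃ λ m → P m × (∀ x → P x → x ≢ m → m ≺ x)
    ≺-least {P} P? (x , px) = go x (spo-wellFounded isStrictPartialOrder x) px
      where
      go : ∀ x → Acc _≺_ x → P x → ∃ λ m → P m × (∀ x → P x → x ≢ m → m ≺ x)
      go x (acc rec) px with Finₚ.any? (λ y → P? y ×-dec (y <? x))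
      ... | yes (y , py , y≺x) = go y (rec y≺x) py
      ... | no none = x , px , λ y py y≢x → case compare x y of λ where
        (tri< x≺y _ _) → x≺y
        (tri≈ _ x≡y _) → contradiction (sym x≡y) y≢x
        (tri> _ _ y≺x) → contradiction (y , py , y≺x) none

    -- e is the minimum of a circuit whose broken circuit C - e lies in T;
    -- equivalently, e lies in the closure of { t ∈ T : e ≺ t }.
    Broken : Subset n → Fin n → Set
    Broken T e = ∃ λ C → Circuit M C × C ⊆ ⁅ e ⁆ ∪ T × IsMin M ord C e

    Broken? : ∀ T → Decidable (Broken T)
    Broken? T e = anySubset? λ C →
      circuit? M C ×-dec ((C ⊆? (⁅ e ⁆ ∪ T)) ×-dec isMin? M ord C e)

    abstract
      broken : Subset n → Subset n
      broken T = comprehension (Broken? T)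

      ∈-broken⁺ : ∀ {T e} → Broken T e → e ∈ broken T
      ∈-broken⁺ {T} = ∈-comprehension⁺ (Broken? T)

      ∈-broken⁻ : ∀ {T e} → e ∈ broken T → Broken T e
      ∈-broken⁻ {T} = ∈-comprehension⁻ (Broken? T)

    Broken-mono : ∀ {T T′ e} → T ⊆ T′ → Broken T e → Broken T′ e
    Broken-mono T⊆T′ (C , circ , C⊆ , min) = C , circ , ⁅e⁆∪-mono T⊆T′ ∘ C⊆ , min

    independent⇒unbroken : ∀ {T e} → Independent T → e ∈ T → ¬ Broken T e
    independent⇒unbroken iT e∈T (C , (¬iC , _) , C⊆eT , _) =
      ¬iC (hereditary (⁅e⁆∪-⊆ e∈T ⊆-refl ∘ C⊆eT) iT)

    -- A dependent set contains a circuit, nonempty since the empty set is independent, and the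
    -- minimum of that circuit is broken in the set.
    unbroken⇒independent : ∀ {T} → (∀ {e} → e ∈ T → ¬ Broken T e) → Independent T
    unbroken⇒independent {T} unbroken = decidable-stable (independent? T) λ ¬iT →
      let C , circ , C⊆T = dependent⇒circuit ¬iT
          m , m∈C , least = ≺-least (_∈? C) (decidable-stable (nonempty? C) λ empty →
            proj₁ circ (subst Independent (sym (Empty-unique empty)) empty-indep))
      in unbroken (C⊆T m∈C) (C , circ , ⊆⁅e⁆∪ m T ∘ C⊆T , m∈C , least)

    -- Let `X` be the part of `I` above `s`. Each `t ∈ C - s` is above `s`, so it lies in `X` or is
    -- broken in `I` by a circuit whose other elements are above `t`, hence in `X`. So the closure
    -- of `X` contains `C - s` and therefore `s`. The hypothesis concerns only `t` above `s`, so
    -- that induction down the order can supply it.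
    Broken-absorb : ∀ {T I s} → Independent I →
      (∀ {t} → s ≺ t → t ∈ T → t ∈ I ⊎ Broken I t) → Broken T s → Broken I s
    Broken-absorb {T} {I} {s} iI T⊆ (C , circ , C⊆sT , s∈C , least) =
      [ (λ s∈X → ⊥-elim (≺-irrefl refl (proj₂ (X⁻ s∈X)))) , broken-by ]′
        (closure-transitive iX (circuit-minus circ s∈C) C-s⊆clX (circuit-minus-plus circ))
      where
      inX? : Decidable λ x → x ∈ I × s ≺ x
      inX? x = (x ∈? I) ×-dec (s <? x)

      X : Subset n
      X = comprehension inX?

      X⁻ : ∀ {x} → x ∈ X → x ∈ I × s ≺ x
      X⁻ = ∈-comprehension⁻ inX?

      X⊆I : X ⊆ I
      X⊆I = proj₁ ∘ X⁻

      X⁺ : ∀ {x} → x ∈ I → s ≺ x → x ∈ X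
      X⁺ x∈I s≺x = ∈-comprehension⁺ inX? (x∈I , s≺x)

      iX : Independent X
      iX = hereditary X⊆I iI

      broken-by : ¬ Independent (⁅ s ⁆ ∪ X) → Broken I s
      -- All elements of this circuit other than `s` lie in `X`, hence above `s`, which makes `s`
      -- its minimum.
      broken-by ¬isX with dependent⇒circuit∋ iX ¬isX
      ... | C′ , circ′ , C′⊆sX , s∈C′ =
        C′ , circ′ , ⁅e⁆∪-mono X⊆I ∘ C′⊆sX , s∈C′ , λ x x∈C′ x≢s →
          [ (λ x≡s → contradiction x≡s x≢s) , proj₂ ∘ X⁻ ]′ (∈-∪⁻ (C′⊆sX x∈C′))

      C-s⊆clX : ∀ {t} → t ∈ C - s → t ∈ X ⊎ ¬ Independent (⁅ t ⁆ ∪ X)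
      C-s⊆clX {t} t∈ with x∈p-y⇒x≢y C s t∈ | p─q⊆p C ⁅ s ⁆ t∈
      ... | t≢s | t∈C with least t t∈C t≢s | ∈-∪⁻ (C⊆sT t∈C)
      ... | s≺t | inj₁ t≡s = contradiction t≡s t≢s
      ... | s≺t | inj₂ t∈T with T⊆ s≺t t∈T
      ... | inj₁ t∈I = inj₁ (X⁺ t∈I s≺t)
      ... | inj₂ (C′ , circ′ , C′⊆tI , t∈C′ , least′) =
        inj₂ λ itX → proj₁ circ′ (hereditary C′⊆tX itX)
        where
        C′⊆tX : C′ ⊆ ⁅ t ⁆ ∪ X
        C′⊆tX {x} x∈C′ with x Finₚ.≟ t | ∈-∪⁻ (C′⊆tI x∈C′)
        ... | yes refl | _        = e∈⁅e⁆∪ t X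
        ... | no  x≢t  | inj₁ x≡t = contradiction x≡t x≢t
        ... | no  x≢t  | inj₂ x∈I = ⊆⁅e⁆∪ t X (X⁺ x∈I (≺-trans s≺t (least′ x x∈C′ x≢t)))

    -- The lexicographically last basis of T.
    greedy : Subset n → Subset n
    greedy T = T ─ broken T

    greedy⊆ : ∀ T → greedy T ⊆ T
    greedy⊆ T = p─q⊆p T (broken T)

    greedy⊎Broken : ∀ T {t} → t ∈ T → t ∈ greedy T ⊎ Broken T t
    greedy⊎Broken T {t} t∈T with t ∈? broken T
    ... | yes b = inj₂ (∈-broken⁻ b)
    ... | no ¬b = inj₁ (x∈p∧x∉q⇒x∈p─q t∈T ¬b)

    -- By monotonicity an element broken in `greedy T` is broken in `T`, and all such elements were
    -- removed.
    greedy-independent : ∀ T → Independent (greedy T)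
    greedy-independent T = unbroken⇒independent λ e∈ b →
      x∈p─q⇒x∉q T (broken T) e∈ (∈-broken⁺ (Broken-mono (greedy⊆ T) b))

    -- Induction from the top of the order downwards: elements of `T` above `s` are in `greedy T` or
    -- already known to be broken in it.
    Broken-greedy : ∀ {T s} → Broken T s → Broken (greedy T) s
    Broken-greedy {T} {s} = go s (spo-noetherian isStrictPartialOrder s)
      where
      go : ∀ s → Acc (flip _≺_) s → Broken T s → Broken (greedy T) s
      go s (acc rec) = Broken-absorb (greedy-independent T) λ s≺t t∈T →
        map₂ (go _ (rec s≺t)) (greedy⊎Broken T t∈T)

    -- `greedy T` alone determines the broken set, so elements of `broken T` may be added to or
    -- removed from `T`. This is what keeps the region of exchange fixed.
    broken-cong : ∀ {T T′} → greedy T ⊆ T′ → (∀ {t} → t ∈ T′ → t ∈ greedy T ⊎ Broken T t) →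
      broken T′ ≡ broken T
    broken-cong {T} {T′} G⊆T′ T′⊆ = ⊆-antisym
      (∈-broken⁺
        ∘ Broken-mono (greedy⊆ T)
        ∘ Broken-absorb (greedy-independent T) (λ _ → map₂ Broken-greedy ∘ T′⊆)
        ∘ ∈-broken⁻)
      (∈-broken⁺
        ∘ Broken-mono G⊆T′
        ∘ Broken-greedy
        ∘ ∈-broken⁻)

    -- Adjoining the least element that keeps I independent breaks nothing new.
    extend-to-basis : ∀ {I} → Independent I →
      ∃ λ B → Basis M B × I ⊆ B × (∀ {s} → Broken B s → Broken I s)
    extend-to-basis {I} = go I (⊃-wellFounded I)
      where
      go : ∀ I → Acc _⊃_ I → Independent I →
        ∃ λ B → Basis M B × I ⊆ B × (∀ {s} → Broken B s → Broken I s)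
      go I (acc rec) iI with Finₚ.any? (λ x → ¬? (x ∈? I) ×-dec independent? (⁅ x ⁆ ∪ I))
      ... | no none = I , (iI , λ A (I⊆A , x , x∈A , x∉I) iA →
              none (x , x∉I , hereditary (⁅e⁆∪-⊆ x∈A I⊆A) iA)) , ⊆-refl , λ b → b
      ... | yes candidate
        with ≺-least (λ x → ¬? (x ∈? I) ×-dec independent? (⁅ x ⁆ ∪ I)) candidate
      ... | x , (x∉I , ixI) , least =
        let B , basis , xI⊆B , B-broken = go (⁅ x ⁆ ∪ I) (rec (⊂-⁅e⁆∪ x∉I)) ixI
        in B , basis , xI⊆B ∘ ⊆⁅e⁆∪ x I , unbreak ∘ B-broken
        where
        unbreak : ∀ {s} → Broken (⁅ x ⁆ ∪ I) s → Broken I s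
        unbreak {s} b@(C , circ , C⊆sxI , s∈C , min) with x ∈? C
        ... | no x∉C = C , circ , C⊆sI , s∈C , min
          where
          C⊆sI : C ⊆ ⁅ s ⁆ ∪ I
          C⊆sI {y} y∈C with ∈-∪⁻ (C⊆sxI y∈C)
          ... | inj₁ refl = e∈⁅e⁆∪ s I
          ... | inj₂ y∈xI with ∈-∪⁻ y∈xI
          ... | inj₁ refl = contradiction y∈C x∉C
          ... | inj₂ y∈I  = ⊆⁅e⁆∪ s I y∈I
        -- Here the closure of `I` would contain `C - x` and hence `x`, against the independence of
        -- `⁅ x ⁆ ∪ I`.
        ... | yes x∈C = ⊥-elim ([ x∉I , (λ ¬i → ¬i ixI) ]′
            (closure-transitive iI (circuit-minus circ x∈C) C-x⊆clI (circuit-minus-plus circ)))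
          where
          s∉xI : s ∉ ⁅ x ⁆ ∪ I
          s∉xI s∈ = independent⇒unbroken ixI s∈ b

          s≺x : s ≺ x
          s≺x = min x x∈C λ where refl → s∉xI (e∈⁅e⁆∪ x I)

          -- Otherwise `s` would be a candidate for adjoining below the least candidate `x`.
          ¬isI : ¬ Independent (⁅ s ⁆ ∪ I)
          ¬isI isI = ≺-asym s≺x
            (least s (s∉xI ∘ ⊆⁅e⁆∪ x I , isI) λ where refl → ≺-irrefl refl s≺x)

          C-x⊆clI : ∀ {t} → t ∈ C - x → t ∈ I ⊎ ¬ Independent (⁅ t ⁆ ∪ I)
          C-x⊆clI {t} t∈ with ∈-∪⁻ (C⊆sxI (p─q⊆p C ⁅ x ⁆ t∈))
          ... | inj₁ refl = inj₂ ¬isI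
          ... | inj₂ t∈xI with ∈-∪⁻ t∈xI
          ... | inj₁ t≡x = contradiction t≡x (x∈p-y⇒x≢y C x t∈)
          ... | inj₂ t∈I = inj₁ t∈I

    -- Each element of `T` is in `B` or broken in `B`, so whatever is broken in `T` is broken in
    -- `B`; but no element of `B` or `EP(B)` is broken in `B`.
    face⇒unbroken : ∀ {S T} → ActFace M ord (S , T) → ∀ {s} → s ∈ S → s ∉ broken T
    face⇒unbroken {S} {T} (B , (iB , _) , S⊆ , T⊆) {s} s∈S s∈b =
      case S⊆ s s∈S of λ where
        (inj₁ s∈B)         → independent⇒unbroken iB s∈B broken-B
        (inj₂ (s∉B , ¬EA)) → ¬EA (s∉B , broken-B)
      where
      broken-B : Broken B s
      broken-B = Broken-absorb iB (λ {t} _ t∈T → map₂ proj₂ (T⊆ t t∈T))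
        (∈-broken⁻ s∈b)

    -- The facet comes from a basis `B` extending `greedy T` without breaking anything new: no
    -- element of `S` is broken in `B`, while every element of `T` outside `greedy T` is.
    unbroken⇒face : ∀ {S T} → (∀ {s} → s ∈ S → s ∉ broken T) → ActFace M ord (S , T)
    unbroken⇒face {S} {T} unbroken =
      let B , basis , G⊆B , B-broken = extend-to-basis (greedy-independent T)
      in B , basis , S⊆ B-broken , T⊆ G⊆B
      where
      S⊆ : ∀ {B} → (∀ {s} → Broken B s → Broken (greedy T) s) →
        ∀ s → s ∈ S → s ∈ B ⊎ EP M ord B s
      S⊆ {B} B-broken s s∈S with s ∈? B
      ... | yes s∈B = inj₁ s∈B
      ... | no  s∉B = inj₂ (s∉B , λ (_ , b) → unbroken s∈S
              (∈-broken⁺ (Broken-mono (greedy⊆ T) (B-broken b))))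

      T⊆ : ∀ {B} → greedy T ⊆ B → ∀ t → t ∈ T → t ∈ B ⊎ EA M ord B t
      T⊆ {B} G⊆B t t∈T with t ∈? B | greedy⊎Broken T t∈T
      ... | yes t∈B | _        = inj₁ t∈B
      ... | no  t∉B | inj₁ t∈G = contradiction (G⊆B t∈G) t∉B
      ... | no  t∉B | inj₂ b   = inj₂ (t∉B , Broken-mono G⊆B (Broken-greedy b))

-- Face sizes and h-vectors

sumℤ : List ℤ → ℤ
sumℤ = foldr ℤ._+_ 0ℤ

sumℤ-++ : ∀ xs ys → sumℤ (xs ++ ys) ≡ sumℤ xs ℤ.+ sumℤ ys
sumℤ-++ []       ys = sym (ℤₚ.+-identityˡ _)
sumℤ-++ (x ∷ xs) ys = trans (cong (ℤ._+_ x) (sumℤ-++ xs ys)) (sym (ℤₚ.+-assoc x _ _))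

sumℤ-map-+ : ∀ {A : Set} (f g : A → ℤ) xs →
  sumℤ (map f xs) ℤ.+ sumℤ (map g xs) ≡ sumℤ (map (λ x → f x ℤ.+ g x) xs)
sumℤ-map-+ f g []       = refl
sumℤ-map-+ f g (x ∷ xs) = trans
  (solve 4 (λ a b c d → (a :+ b) :+ (c :+ d) := (a :+ c) :+ (b :+ d)) refl
    (f x) (sumℤ (map f xs)) (g x) (sumℤ (map g xs)))
  (cong (ℤ._+_ (f x ℤ.+ g x)) (sumℤ-map-+ f g xs))
  where open +-*-Solver

sumℤ-↭ : ∀ {xs ys} → xs ↭ ys → sumℤ xs ≡ sumℤ ys
sumℤ-↭ = ↭ₛₚ.foldr-commMonoid (setoid ℤ) ℤₚ.+-0-isCommutativeMonoid ∘ ↭⇒↭ₛ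

faceDim-↭ : ∀ {xs ys} → xs ↭ ys → faceDim xs ≡ faceDim ys
faceDim-↭ = ↭ₛₚ.foldr-commMonoid (setoid ℕ) ℕₚ.⊔-0-isCommutativeMonoid ∘ ↭⇒↭ₛ

-- The sequence `t` cut off to zero from index `m` on, evaluated at `s`. With recursion on `m` and
-- `s` together, a simultaneous shift holds by definition.
restrict : ℕ → (ℕ → ℤ) → ℕ → ℤ
restrict zero    t s       = 0ℤ
restrict (suc m) t zero    = t zero
restrict (suc m) t (suc s) = restrict m (t ∘ suc) s

restrict-zero : ∀ m t s → t s ≡ 0ℤ → restrict m t s ≡ 0ℤ
restrict-zero zero    t s       eq = refl
restrict-zero (suc m) t zero    eq = eq
restrict-zero (suc m) t (suc s) eq = restrict-zero m (t ∘ suc) s eq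

δ : ℕ → ℕ → ℕ
δ s i = if does (s ℕ.≟ i) then 1 else 0

fVec-∷ : ∀ s sizes i → fVec (s ∷ sizes) i ≡ δ s i ℕ.+ fVec sizes i
fVec-∷ s sizes i with does (s ℕ.≟ i)
... | true  = refl
... | false = refl

sum-zero : ∀ m (f : ℕ → ℤ) → (∀ i → f i ≡ 0ℤ) → sumℤ (applyUpTo f m) ≡ 0ℤ
sum-zero zero    f f≡0 = refl
sum-zero (suc m) f f≡0 = cong₂ ℤ._+_ (f≡0 0) (sum-zero m (f ∘ suc) (f≡0 ∘ suc))

scaled : (ℕ → ℤ) → (ℕ → ℕ) → (ℕ → ℕ) → ℕ → ℤ
scaled c b f i = c i ℤ.* ℤ.+ (b i ℕ.* f i)

scaled-0 : ∀ c b i → scaled c b (λ _ → 0) i ≡ 0ℤ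
scaled-0 c b i = trans (cong (λ z → c i ℤ.* ℤ.+ z) (ℕₚ.*-zeroʳ (b i))) (ℤₚ.*-zeroʳ (c i))

scaled-+ : ∀ c b f g i → scaled c b (λ j → f j ℕ.+ g j) i ≡ scaled c b f i ℤ.+ scaled c b g i
scaled-+ c b f g i = trans
  (cong (λ z → c i ℤ.* ℤ.+ z) (ℕₚ.*-distribˡ-+ (b i) (f i) (g i)))
  (trans (cong (c i ℤ.*_) (ℤₚ.pos-+ (b i ℕ.* f i) (b i ℕ.* g i)))
    (ℤₚ.*-distribˡ-+ (c i) (ℤ.+ (b i ℕ.* f i)) (ℤ.+ (b i ℕ.* g i))))

sum-δ : ∀ m c b s →
  sumℤ (applyUpTo (scaled c b (δ s)) m) ≡ restrict m (λ i → c i ℤ.* ℤ.+ b i) s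
sum-δ zero    c b s       = refl
sum-δ (suc m) c b zero    = trans
  (cong₂ ℤ._+_ (cong (λ z → c 0 ℤ.* ℤ.+ z) (ℕₚ.*-identityʳ (b 0)))
    (sum-zero m (scaled c b (δ 0) ∘ suc) (scaled-0 c b ∘ suc)))
  (ℤₚ.+-identityʳ _)
sum-δ (suc m) c b (suc s) = trans
  (cong₂ ℤ._+_ (scaled-0 c b 0) (sum-δ m (c ∘ suc) (b ∘ suc) s))
  (ℤₚ.+-identityˡ _)

-- Interchange of summation: a sum over sizes weighted by face numbers becomes a sum over single
-- faces, which is additive in the list and invariant under permutation.
sum-fVec : ∀ m c b sizes →
  sumℤ (map (scaled c b (fVec sizes)) (upTo m)) ≡
  sumℤ (map (restrict m (λ i → c i ℤ.* ℤ.+ b i)) sizes)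
sum-fVec m c b [] = trans (cong sumℤ (Listₚ.map-upTo (scaled c b (λ _ → 0)) m))
  (sum-zero m (scaled c b (λ _ → 0)) (scaled-0 c b))
sum-fVec m c b (s ∷ sizes) = begin
  sumℤ (map (scaled c b (fVec (s ∷ sizes))) (upTo m))
    ≡⟨ cong sumℤ (Listₚ.map-cong split (upTo m)) ⟩
  sumℤ (map (λ i → scaled c b (δ s) i ℤ.+ scaled c b (fVec sizes) i) (upTo m))
    ≡⟨ sumℤ-map-+ (scaled c b (δ s)) (scaled c b (fVec sizes)) (upTo m) ⟨
  sumℤ (map (scaled c b (δ s)) (upTo m)) ℤ.+ sumℤ (map (scaled c b (fVec sizes)) (upTo m))
    ≡⟨ cong₂ ℤ._+_
         (trans (cong sumℤ (Listₚ.map-upTo (scaled c b (δ s)) m)) (sum-δ m c b s))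
         (sum-fVec m c b sizes) ⟩
  restrict m _ s ℤ.+ sumℤ (map (restrict m _) sizes) ∎
  where
  open ≡-Reasoning
  split : ∀ i → scaled c b (fVec (s ∷ sizes)) i ≡ scaled c b (δ s) i ℤ.+ scaled c b (fVec sizes) i
  split i = trans (cong (λ f → c i ℤ.* ℤ.+ (b i ℕ.* f)) (fVec-∷ s sizes i))
    (scaled-+ c b (δ s) (fVec sizes) i)

-- The contribution of one face of size s to h_k in dimension d - 1, namely the
-- coefficient of y^k in y^s (1-y)^(d-s).
contribution : ℕ → ℕ → ℕ → ℤ
contribution d k = restrict (suc k) λ i → sign (k ∸ i) ℤ.* ℤ.+ choose (d ∸ i) (k ∸ i)

-- Coefficients of `y^k` in `y^(s+1) (1-y)^(d-s) + y^s (1-y)^(d+1-s) = y^s (1-y)^(d-s)`. For `s = 0`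
-- this is Pascal's rule.
contribution-pascal : ∀ {d s} k → s ℕ.≤ d →
  contribution (suc d) k (suc s) ℤ.+ contribution (suc d) k s ≡ contribution d k s
contribution-pascal {d} zero z≤n = refl
contribution-pascal {d} {zero} (suc k) z≤n = begin
  sign k ℤ.* ℤ.+ choose d k ℤ.+ sign (suc k) ℤ.* ℤ.+ choose (suc d) (suc k)
    ≡⟨ cong (λ z → sign k ℤ.* ℤ.+ choose d k ℤ.+ sign (suc k) ℤ.* ℤ.+ z)
         (nCk+nC[k+1]≡[n+1]C[k+1] d k) ⟨
  sign k ℤ.* ℤ.+ choose d k ℤ.+ ℤ.- sign k ℤ.* ℤ.+ (choose d k ℕ.+ choose d (suc k))
    ≡⟨ cong (λ z → sign k ℤ.* ℤ.+ choose d k ℤ.+ ℤ.- sign k ℤ.* z)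
         (ℤₚ.pos-+ (choose d k) (choose d (suc k))) ⟩
  sign k ℤ.* ℤ.+ choose d k ℤ.+ ℤ.- sign k ℤ.* (ℤ.+ choose d k ℤ.+ ℤ.+ choose d (suc k))
    ≡⟨ solve 3 (λ σ a b → σ :* a :+ :- σ :* (a :+ b) := :- σ :* b) refl
         (sign k) (ℤ.+ choose d k) (ℤ.+ choose d (suc k)) ⟩
  sign (suc k) ℤ.* ℤ.+ choose d (suc k) ∎
  where
  open ≡-Reasoning
  open +-*-Solver
contribution-pascal {suc d} {suc s} zero s≤d = refl
-- A common factor `y` cancels, lowering `d`, `k` and `s` together.
contribution-pascal (suc k) (s≤s s≤d) = contribution-pascal k s≤d

-- `y^s (1-y)^(d-s)` has degree `d`, in agreement with the extension of the h-vector by zeros.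
contribution-beyond : ∀ {d k s} → s ℕ.≤ d → d ℕ.< k → contribution d k s ≡ 0ℤ
contribution-beyond {d} {k} {s} s≤d d<k = restrict-zero (suc k) _ s
  (trans (cong (λ z → sign (k ∸ s) ℤ.* ℤ.+ z) (k>n⇒nCk≡0 (ℕₚ.∸-monoˡ-< d<k s≤d)))
    (ℤₚ.*-zeroʳ (sign (k ∸ s))))

hSum : ℕ → ℕ → List ℕ → ℤ
hSum d k sizes = sumℤ (map (contribution d k) sizes)

faceDim-bound : ∀ sizes → All (ℕ._≤ faceDim sizes) sizes
faceDim-bound []           = []
faceDim-bound (s ∷ sizes) = ℕₚ.m≤m⊔n s (faceDim sizes)
  ∷ All.map (λ s≤ → ℕₚ.≤-trans s≤ (ℕₚ.m≤n⊔m s (faceDim sizes))) (faceDim-bound sizes)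

sum-map-zero : ∀ {A : Set} {f : A → ℤ} {xs} → All (λ x → f x ≡ 0ℤ) xs → sumℤ (map f xs) ≡ 0ℤ
sum-map-zero []         = refl
sum-map-zero (eq ∷ eqs) = cong₂ ℤ._+_ eq (sum-map-zero eqs)

hVector≡hSum : ∀ sizes k → hVector sizes k ≡ hSum (faceDim sizes) k sizes
hVector≡hSum sizes k with k ℕ.≤? faceDim sizes
... | yes _   = sum-fVec (suc k) (λ i → sign (k ∸ i)) (λ i → choose (faceDim sizes ∸ i) (k ∸ i)) sizes
... | no  k≰d = sym (sum-map-zero
  (All.map (λ s≤d → contribution-beyond s≤d (ℕₚ.≰⇒> k≰d)) (faceDim-bound sizes)))

hVector-↭ : ∀ {xs ys} → xs ↭ ys → ∀ k → hVector xs k ≡ hVector ys k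
hVector-↭ {xs} {ys} p k = begin
  hVector xs k            ≡⟨ hVector≡hSum xs k ⟩
  hSum (faceDim xs) k xs  ≡⟨ cong (λ d → hSum d k xs) (faceDim-↭ p) ⟩
  hSum (faceDim ys) k xs  ≡⟨ sumℤ-↭ (↭ₚ.map⁺ (contribution (faceDim ys) k) p) ⟩
  hSum (faceDim ys) k ys  ≡⟨ hVector≡hSum ys k ⟨
  hVector ys k            ∎
  where open ≡-Reasoning

-- Cones and joins with a simplex

faceDim-++ : ∀ xs ys → faceDim (xs ++ ys) ≡ faceDim xs ⊔ faceDim ys
faceDim-++ []       ys = refl
faceDim-++ (x ∷ xs) ys = trans (cong (x ⊔_) (faceDim-++ xs ys)) (sym (ℕₚ.⊔-assoc x _ _))

-- The list is nonempty because the default value 0 for the empty list would not rise.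
faceDim-map-suc : ∀ x xs → faceDim (map suc (x ∷ xs)) ≡ suc (faceDim (x ∷ xs))
faceDim-map-suc x []       = cong suc (sym (ℕₚ.⊔-identityʳ x))
faceDim-map-suc x (y ∷ xs) = cong (suc x ⊔_) (faceDim-map-suc y xs)

-- Face sizes of the cone over a complex.
cone : List ℕ → List ℕ
cone sizes = map suc sizes ++ sizes

faceDim-cone : ∀ x xs → faceDim (cone (x ∷ xs)) ≡ suc (faceDim (x ∷ xs))
faceDim-cone x xs = begin
  faceDim (cone (x ∷ xs))                          ≡⟨ faceDim-++ (map suc (x ∷ xs)) (x ∷ xs) ⟩
  faceDim (map suc (x ∷ xs)) ⊔ faceDim (x ∷ xs)    ≡⟨ cong (_⊔ faceDim (x ∷ xs)) (faceDim-map-suc x xs) ⟩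
  suc (faceDim (x ∷ xs)) ⊔ faceDim (x ∷ xs)        ≡⟨ ℕₚ.m≥n⇒m⊔n≡m (ℕₚ.n≤1+n _) ⟩
  suc (faceDim (x ∷ xs))                           ∎
  where open ≡-Reasoning

-- A face of size `s` yields two faces of the cone, of sizes `s + 1` and `s`, whose contributions in
-- the raised dimension add up to the old one.
hSum-cone : ∀ d k {sizes} → All (ℕ._≤ d) sizes → hSum (suc d) k (cone sizes) ≡ hSum d k sizes
hSum-cone d k {sizes} bounds = begin
  sumℤ (map h′ (map suc sizes ++ sizes))
    ≡⟨ cong sumℤ (Listₚ.map-++ h′ (map suc sizes) sizes) ⟩
  sumℤ (map h′ (map suc sizes) ++ map h′ sizes)
    ≡⟨ sumℤ-++ (map h′ (map suc sizes)) (map h′ sizes) ⟩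
  sumℤ (map h′ (map suc sizes)) ℤ.+ sumℤ (map h′ sizes)
    ≡⟨ cong (λ l → sumℤ l ℤ.+ sumℤ (map h′ sizes)) (Listₚ.map-∘ sizes) ⟨
  sumℤ (map (h′ ∘ suc) sizes) ℤ.+ sumℤ (map h′ sizes)
    ≡⟨ sumℤ-map-+ (h′ ∘ suc) h′ sizes ⟩
  sumℤ (map (λ s → h′ (suc s) ℤ.+ h′ s) sizes)
    ≡⟨ cong sumℤ (Listₚ.map-cong-local (All.map (contribution-pascal k) bounds)) ⟩
  sumℤ (map (contribution d k) sizes) ∎
  where
  open ≡-Reasoning
  h′ = contribution (suc d) k

hVector-cone : ∀ sizes k → hVector (cone sizes) k ≡ hVector sizes k
-- The complex without faces is separate: its cone is again empty, so its dimension does not rise.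
hVector-cone []            k = refl
hVector-cone sizes@(x ∷ xs) k = begin
  hVector (cone sizes) k
    ≡⟨ hVector≡hSum (cone sizes) k ⟩
  hSum (faceDim (cone sizes)) k (cone sizes)
    ≡⟨ cong (λ d → hSum d k (cone sizes)) (faceDim-cone x xs) ⟩
  hSum (suc (faceDim sizes)) k (cone sizes)
    ≡⟨ hSum-cone (faceDim sizes) k (faceDim-bound sizes) ⟩
  hSum (faceDim sizes) k sizes
    ≡⟨ hVector≡hSum sizes k ⟨
  hVector sizes k ∎
  where open ≡-Reasoning

-- Face sizes of the join of a complex with the full simplex on n vertices.
simplexJoin : ℕ → List ℕ → List ℕ
simplexJoin n = cartesianProductWith (λ A s → ∣ A ∣ ℕ.+ s) (allSubsets n)

module _ {A B C : Set} where

  cartesianProductWith-mapˡ : ∀ {D : Set} (f : A → B → C) (g : D → A) xs ys →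
    cartesianProductWith f (map g xs) ys ≡ cartesianProductWith (f ∘ g) xs ys
  cartesianProductWith-mapˡ f g []       ys = refl
  cartesianProductWith-mapˡ f g (x ∷ xs) ys =
    cong (map (f (g x)) ys ++_) (cartesianProductWith-mapˡ f g xs ys)

  map-cartesianProductWith : ∀ {D : Set} (g : C → D) (f : A → B → C) xs ys →
    map g (cartesianProductWith f xs ys) ≡ cartesianProductWith (λ x y → g (f x y)) xs ys
  map-cartesianProductWith g f []       ys = refl
  map-cartesianProductWith g f (x ∷ xs) ys = trans
    (Listₚ.map-++ g (map (f x) ys) (cartesianProductWith f xs ys))
    (cong₂ _++_ (sym (Listₚ.map-∘ ys)) (map-cartesianProductWith g f xs ys))

simplexJoin-zero : ∀ sizes → simplexJoin 0 sizes ≡ sizes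
simplexJoin-zero sizes = trans (Listₚ.++-identityʳ (map id sizes)) (Listₚ.map-id sizes)

-- Splitting subsets by whether they contain the first vertex shows that one more vertex of the
-- simplex is one more cone point.
simplexJoin-suc : ∀ n sizes → simplexJoin (suc n) sizes ≡ cone (simplexJoin n sizes)
simplexJoin-suc n sizes = begin
  simplexJoin (suc n) sizes
    ≡⟨ Listₚ.cartesianProductWith-distribʳ-++ _∔_ (map (true ∷_) (allSubsets n)) _ sizes ⟩
  cartesianProductWith _∔_ (map (true ∷_) (allSubsets n)) sizes ++
  cartesianProductWith _∔_ (map (false ∷_) (allSubsets n)) sizes
    ≡⟨ cong₂ _++_ (cartesianProductWith-mapˡ _∔_ (true ∷_) (allSubsets n) sizes)
                  (cartesianProductWith-mapˡ _∔_ (false ∷_) (allSubsets n) sizes) ⟩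
  cartesianProductWith (λ A s → suc (∣ A ∣ ℕ.+ s)) (allSubsets n) sizes ++ simplexJoin n sizes
    ≡⟨ cong (_++ simplexJoin n sizes)
         (map-cartesianProductWith suc (λ A s → ∣ A ∣ ℕ.+ s) (allSubsets n) sizes) ⟨
  cone (simplexJoin n sizes) ∎
  where
  open ≡-Reasoning
  _∔_ : Subset (suc n) → ℕ → ℕ
  A ∔ s = ∣ A ∣ ℕ.+ s

hVector-simplexJoin : ∀ n sizes k → hVector (simplexJoin n sizes) k ≡ hVector sizes k
hVector-simplexJoin zero    sizes k = cong (λ l → hVector l k) (simplexJoin-zero sizes)
hVector-simplexJoin (suc n) sizes k = trans
  (cong (λ l → hVector l k) (simplexJoin-suc n sizes))
  (trans (hVector-cone (simplexJoin n sizes) k) (hVector-simplexJoin n sizes k))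

-- Enumeration of pairs and counting along an involution

allSubsets-complete : ∀ {n} (A : Subset n) → A ∈ˡ allSubsets n
allSubsets-complete []          = here refl
allSubsets-complete (true  ∷ A) = ∈-++⁺ˡ (∈-map⁺ (true ∷_) (allSubsets-complete A))
allSubsets-complete {suc n} (false ∷ A) =
  ∈-++⁺ʳ (map (true ∷_) (allSubsets n)) (∈-map⁺ (false ∷_) (allSubsets-complete A))

allSubsets-unique : ∀ n → Unique (allSubsets n)
allSubsets-unique zero    = [] AllPairs.∷ AllPairs.[]
allSubsets-unique (suc n) = Uniqueₚ.++⁺
  (Uniqueₚ.map⁺ Vecₚ.∷-injectiveʳ (allSubsets-unique n))
  (Uniqueₚ.map⁺ Vecₚ.∷-injectiveʳ (allSubsets-unique n))
  λ (∈true , ∈false) → case ∈-map⁻ (true ∷_) ∈true of λ where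
    (_ , _ , refl) → case ∈-map⁻ (false ∷_) ∈false of λ where
      (_ , _ , ())

concatMap-pair : ∀ {A B : Set} (xs : List A) (ys : List B) →
  concatMap (λ x → map (x ,_) ys) xs ≡ cartesianProduct xs ys
concatMap-pair []       ys = refl
concatMap-pair (x ∷ xs) ys = cong (map (x ,_) ys ++_) (concatMap-pair xs ys)

allPairs≡cartesianProduct : ∀ n → allPairs n ≡ cartesianProduct (allSubsets n) (allSubsets n)
allPairs≡cartesianProduct n = concatMap-pair (allSubsets n) (allSubsets n)

allPairs-complete : ∀ {n} (p : Subset n × Subset n) → p ∈ˡ allPairs n
allPairs-complete {n} (S , T) = subst ((S , T) ∈ˡ_) (sym (allPairs≡cartesianProduct n))
  (∈-cartesianProduct⁺ (allSubsets-complete S) (allSubsets-complete T))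

allPairs-unique : ∀ n → Unique (allPairs n)
allPairs-unique n = subst Unique (sym (allPairs≡cartesianProduct n))
  (Uniqueₚ.cartesianProduct⁺ (allSubsets-unique n) (allSubsets-unique n))

filter-map : ∀ {A B : Set} {Q : Pred B 0ℓ} (Q? : Decidable Q) (f : A → B) xs →
  filter Q? (map f xs) ≡ map f (filter (Q? ∘ f) xs)
filter-map Q? f []       = refl
filter-map Q? f (x ∷ xs) with does (Q? (f x))
... | true  = cong (f x ∷_) (filter-map Q? f xs)
... | false = filter-map Q? f xs

module _ {A : Set} {f : A → A} (f-involutive : ∀ x → f (f x) ≡ x)
         {xs : List A} (unique : Unique xs) (complete : ∀ x → x ∈ˡ xs) where

  -- Both lists are free of repetitions and contain every element of the type.
  map-involution-↭ : map f xs ↭ xs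
  map-involution-↭ = ∼bag⇒↭ (unique∧set⇒bag (Uniqueₚ.map⁺ injective unique) unique
    (mk⇔ (λ _ → complete _) (λ _ → subst (_∈ˡ map f xs) (f-involutive _) (∈-map⁺ f (complete _)))))
    where
    injective : ∀ {x y} → f x ≡ f y → x ≡ y
    injective {x} {y} eq = trans (sym (f-involutive x)) (trans (cong f eq) (f-involutive y))

  -- `P` is the pullback of `Q` along the involution `f`, so `f` matches the elements kept on each
  -- side, and `g` is constant along the matching.
  filter-involution-↭ : ∀ {B : Set} {P Q : Pred A 0ℓ} (P? : Decidable P) (Q? : Decidable Q) →
    (∀ {x} → P x → Q (f x)) → (∀ {x} → Q (f x) → P x) →
    (g : A → B) → (∀ x → g (f x) ≡ g x) → map g (filter P? xs) ↭ map g (filter Q? xs)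
  filter-involution-↭ P? Q? P⇒Q Q⇒P g g∘f≗g = begin
    map g (filter P? xs)              ≡⟨ cong (map g) (Listₚ.filter-≐ P? (Q? ∘ f) (P⇒Q , Q⇒P) xs) ⟩
    map g (filter (Q? ∘ f) xs)        ≡⟨ Listₚ.map-cong g∘f≗g (filter (Q? ∘ f) xs) ⟨
    map (g ∘ f) (filter (Q? ∘ f) xs)  ≡⟨ Listₚ.map-∘ (filter (Q? ∘ f) xs) ⟩
    map g (map f (filter (Q? ∘ f) xs)) ≡⟨ cong (map g) (filter-map Q? f xs) ⟨
    map g (filter Q? (map f xs))      ↭⟨ ↭ₚ.map⁺ g (↭ₚ.filter-↭ Q? map-involution-↭) ⟩
    map g (filter Q? xs)              ∎
    where open PermutationReasoning

totalSize : Subset n × Subset n → ℕ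
totalSize p = ∣ proj₁ p ∣ ℕ.+ ∣ proj₂ p ∣

totalSizes≡simplexJoin : ∀ {Q : Pred (Subset n) 0ℓ} (Q? : Decidable Q) →
  map totalSize (filter (Q? ∘ proj₂) (allPairs n)) ≡
  simplexJoin n (map ∣_∣ (filter Q? (allSubsets n)))
totalSizes≡simplexJoin {n} Q? = go (allSubsets n)
  where
  open ≡-Reasoning
  ys = allSubsets n
  go : ∀ xs → map totalSize (filter (Q? ∘ proj₂) (concatMap (λ S → map (S ,_) ys) xs)) ≡
    cartesianProductWith (λ A s → ∣ A ∣ ℕ.+ s) xs (map ∣_∣ (filter Q? ys))
  go []       = refl
  go (S ∷ xs) = begin
    map totalSize (filter (Q? ∘ proj₂) (map (S ,_) ys ++ rest))
      ≡⟨ cong (map totalSize) (Listₚ.filter-++ (Q? ∘ proj₂) (map (S ,_) ys) rest) ⟩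
    map totalSize (filter (Q? ∘ proj₂) (map (S ,_) ys) ++ filter (Q? ∘ proj₂) rest)
      ≡⟨ Listₚ.map-++ totalSize (filter (Q? ∘ proj₂) (map (S ,_) ys)) _ ⟩
    map totalSize (filter (Q? ∘ proj₂) (map (S ,_) ys)) ++ map totalSize (filter (Q? ∘ proj₂) rest)
      ≡⟨ cong₂ _++_ (cong (map totalSize) (filter-map (Q? ∘ proj₂) (S ,_) ys)) (go xs) ⟩
    map totalSize (map (S ,_) (filter Q? ys)) ++ _
      ≡⟨ cong (_++ _) (Listₚ.map-∘ (filter Q? ys)) ⟨
    map (λ T → ∣ S ∣ ℕ.+ ∣ T ∣) (filter Q? ys) ++ _
      ≡⟨ cong (_++ _) (Listₚ.map-∘ (filter Q? ys)) ⟩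
    map (∣ S ∣ ℕ.+_) (map ∣_∣ (filter Q? ys)) ++ _ ∎
    where rest = concatMap (λ S → map (S ,_) ys) xs

-- The exchange involution

∣∷∣-+ : ∀ s t (S T : Subset n) →
  ∣ s ∷ S ∣ ℕ.+ ∣ t ∷ T ∣ ≡ (∣ s ∷ [] ∣ ℕ.+ ∣ t ∷ [] ∣) ℕ.+ (∣ S ∣ ℕ.+ ∣ T ∣)
∣∷∣-+ true  true  S T = cong suc (ℕₚ.+-suc ∣ S ∣ ∣ T ∣)
∣∷∣-+ true  false S T = refl
∣∷∣-+ false true  S T = ℕₚ.+-suc ∣ S ∣ ∣ T ∣
∣∷∣-+ false false S T = refl

-- The set `(S ∖ Z) ∪ (T ∩ Z)`. Together, `mux Z S T` and `mux Z T S` are `S` and `T` with their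
-- parts inside `Z` exchanged.
mux : Subset n → Subset n → Subset n → Subset n
mux []          []      []      = []
mux (true  ∷ Z) (_ ∷ S) (t ∷ T) = t ∷ mux Z S T
mux (false ∷ Z) (s ∷ S) (_ ∷ T) = s ∷ mux Z S T

mux-mux : ∀ (Z S T : Subset n) → mux Z (mux Z S T) (mux Z T S) ≡ S
mux-mux []          []      []      = refl
mux-mux (true  ∷ Z) (s ∷ S) (t ∷ T) = cong (s ∷_) (mux-mux Z S T)
mux-mux (false ∷ Z) (s ∷ S) (t ∷ T) = cong (s ∷_) (mux-mux Z S T)

∈-mux⁺-in : ∀ {x} (Z S T : Subset n) → x ∈ Z → x ∈ T → x ∈ mux Z S T
∈-mux⁺-in (true  ∷ Z) (_ ∷ S) (_ ∷ T) here      here      = here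
∈-mux⁺-in (true  ∷ Z) (_ ∷ S) (_ ∷ T) (there z) (there t) = there (∈-mux⁺-in Z S T z t)
∈-mux⁺-in (false ∷ Z) (_ ∷ S) (_ ∷ T) (there z) (there t) = there (∈-mux⁺-in Z S T z t)

∈-mux⁺-out : ∀ {x} (Z S T : Subset n) → x ∉ Z → x ∈ S → x ∈ mux Z S T
∈-mux⁺-out (true  ∷ Z) (_ ∷ S) (_ ∷ T) x∉Z here      = contradiction here x∉Z
∈-mux⁺-out (false ∷ Z) (_ ∷ S) (_ ∷ T) x∉Z here      = here
∈-mux⁺-out (true  ∷ Z) (_ ∷ S) (_ ∷ T) x∉Z (there s) = there (∈-mux⁺-out Z S T (x∉Z ∘ there) s)
∈-mux⁺-out (false ∷ Z) (_ ∷ S) (_ ∷ T) x∉Z (there s) = there (∈-mux⁺-out Z S T (x∉Z ∘ there) s)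

-- Exchanging again restores `T` and `S`, so the introduction rules, applied to the exchanged sets,
-- also serve for elimination.
∈-mux⁻ : ∀ {x} (Z S T : Subset n) → x ∈ mux Z S T → (x ∈ Z × x ∈ T) ⊎ (x ∉ Z × x ∈ S)
∈-mux⁻ {x = x} Z S T x∈ with x ∈? Z
... | yes x∈Z = inj₁ (x∈Z , subst (x ∈_) (mux-mux Z T S) (∈-mux⁺-in Z (mux Z T S) (mux Z S T) x∈Z x∈))
... | no  x∉Z = inj₂ (x∉Z , subst (x ∈_) (mux-mux Z S T) (∈-mux⁺-out Z (mux Z S T) (mux Z T S) x∉Z x∈))

∣mux∣ : ∀ (Z S T : Subset n) → ∣ mux Z S T ∣ ℕ.+ ∣ mux Z T S ∣ ≡ ∣ S ∣ ℕ.+ ∣ T ∣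
∣mux∣ []          []      []      = refl
∣mux∣ (true  ∷ Z) (s ∷ S) (t ∷ T) = trans (∣∷∣-+ t s (mux Z S T) (mux Z T S))
  (trans (cong₂ ℕ._+_ (ℕₚ.+-comm ∣ t ∷ [] ∣ ∣ s ∷ [] ∣) (∣mux∣ Z S T)) (sym (∣∷∣-+ s t S T)))
∣mux∣ (false ∷ Z) (s ∷ S) (t ∷ T) = trans (∣∷∣-+ s t (mux Z S T) (mux Z T S))
  (trans (cong ((∣ s ∷ [] ∣ ℕ.+ ∣ t ∷ [] ∣) ℕ.+_) (∣mux∣ Z S T)) (sym (∣∷∣-+ s t S T)))

module _ (M : Matroid n) {_≺_ : Rel (Fin n) 0ℓ} (ord : IsStrictTotalOrder _≡_ _≺_) where
  open Matroid M

  private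
    Z : Subset n → Subset n
    Z = broken M ord

  exchange : Subset n × Subset n → Subset n × Subset n
  exchange (S , T) = mux (Z T) S T , mux (Z T) T S

  -- The new second component keeps `greedy T`, which avoids `Z T`, and all its other elements lie
  -- in `Z T`.
  exchange-broken : ∀ S T → Z (mux (Z T) T S) ≡ Z T
  exchange-broken S T = broken-cong M ord
    (λ {t} t∈ → ∈-mux⁺-out (Z T) T S (x∈p─q⇒x∉q T (Z T) t∈) (greedy⊆ M ord T t∈))
    (λ {t} t∈ → case ∈-mux⁻ (Z T) T S t∈ of λ where
      (inj₁ (t∈Z , _))   → inj₂ (∈-broken⁻ M ord t∈Z)
      (inj₂ (t∉Z , t∈T)) → inj₁ (x∈p∧x∉q⇒x∈p─q t∈T t∉Z))

  exchange-involutive : ∀ p → exchange (exchange p) ≡ p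
  exchange-involutive (S , T) = trans
    (cong (λ z → mux z S′ T′ , mux z T′ S′) (exchange-broken S T))
    (cong₂ _,_ (mux-mux (Z T) S T) (mux-mux (Z T) T S))
    where
    S′ = mux (Z T) S T
    T′ = mux (Z T) T S

  -- An element of the exchanged second component that is broken there lies in `Z T`, so it came
  -- from `S`; but in a face `S` avoids `Z T`.
  face⇒exchange-independent : ∀ {p} → ActFace M ord p → Independent (proj₂ (exchange p))
  face⇒exchange-independent {S , T} face = unbroken⇒independent M ord λ {e} e∈ b →
    let e∈Z = subst (e ∈_) (exchange-broken S T) (∈-broken⁺ M ord b)
    in case ∈-mux⁻ (Z T) T S e∈ of λ where
      (inj₁ (_ , e∈S)) → face⇒unbroken M ord face e∈S e∈Z
      (inj₂ (e∉Z , _)) → e∉Z e∈Z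

  -- An element of `S` in `Z T` would be moved into the exchanged second component and be broken
  -- there.
  exchange-independent⇒face : ∀ {p} → Independent (proj₂ (exchange p)) → ActFace M ord p
  exchange-independent⇒face {S , T} i = unbroken⇒face M ord λ {s} s∈S s∈Z →
    independent⇒unbroken M ord i (∈-mux⁺-in (Z T) T S s∈Z s∈S)
      (∈-broken⁻ M ord (subst (s ∈_) (sym (exchange-broken S T)) s∈Z))

  ActSizes-↭ : ActSizes M ord ↭ simplexJoin n (INSizes M)
  ActSizes-↭ = begin
    ActSizes M ord
      ↭⟨ filter-involution-↭ exchange-involutive (allPairs-unique n) allPairs-complete
           (actFace? M ord) (independent? ∘ proj₂)
           face⇒exchange-independent exchange-independent⇒face
           totalSize (λ (S , T) → ∣mux∣ (Z T) S T) ⟩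
    map totalSize (filter (independent? ∘ proj₂) (allPairs n))
      ≡⟨ totalSizes≡simplexJoin independent? ⟩
    simplexJoin n (INSizes M) ∎
    where open PermutationReasoning

theorem1p3 : (n : ℕ) (M : Matroid n) (_≺_ : Rel (Fin n) 0ℓ)
    (ord : IsStrictTotalOrder _≡_ _≺_) →
    ∀ k → hVector (ActSizes M ord) k ≡ hVector (INSizes M) k
theorem1p3 n M _≺_ ord k = trans
  (hVector-↭ (ActSizes-↭ M ord) k)
  (hVector-simplexJoin n (INSizes M) k)
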